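{- Fix an integer $m\geq 0$. For integers $n\geq m$ and $0\leq k\leq n-m$ let $$NA_{\langle m\rangle}(n,k)=\frac{m+1}{n+2}\binom{n+2}{k+1}\binom{n-m}{k}.$$ Then the infinite matrix $$N_{A,\langle m\rangle}^{\square}=\left[NA_{\langle m\rangle}(n+k,k)\right]_{n\geq m,\ k\geq 0}$$ (rows indexed by $n\ge m$, columns by $k\ge 0$) is strictly totally positive.
   Context: A (finite or infinite) real matrix is strictly totally positive (STP) if all of its minors are positive. -}

module Defs where

open import Data.Nat using (ℕ; zero; suc; _+_; _∸_)
import Data.Nat as ℕ
open import Data.Nat.Combinatorics using (_C_)
open import Data.Integer using (+_)
open import Data.Fin using (Fin; zero; suc; punchIn)
open import Data.Rational using (ℚ; 0ℚ; 1ℚ; _*_; -_; _/_; _<_) renaming (_+_ to _+ℚ_)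

∑ : ∀ {n} → (Fin n → ℚ) → ℚ
∑ {zero}  f = 0ℚ
∑ {suc n} f = f zero +ℚ ∑ (λ i → f (suc i))

sgn : ∀ {n} → Fin n → ℚ
sgn zero    = 1ℚ
sgn (suc j) = - sgn j

det : ∀ {n} → (Fin n → Fin n → ℚ) → ℚ
det {zero}  M = 1ℚ
det {suc n} M = ∑ (λ j → sgn j * M zero j * det (λ i k → M (suc i) (punchIn j k)))

StrictlyIncreasing : ∀ {r} → (Fin r → ℕ) → Set
StrictlyIncreasing {r} f = ∀ (i j : Fin r) → i Data.Fin.< j → f i ℕ.< f j

STP : (ℕ → ℕ → ℚ) → Set
STP A = ∀ (r : ℕ) (rows cols : Fin (suc r) → ℕ) →
        StrictlyIncreasing rows → StrictlyIncreasing cols →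
        0ℚ < det (λ i j → A (rows i) (cols j))

ℕtoℚ : ℕ → ℚ
ℕtoℚ x = (+ x) / 1

-- NA_⟨m⟩(n,k) = (m+1)/(n+2) * C(n+2,k+1) * C(n-m,k)   (used for n ≥ m)
NA : ℕ → ℕ → ℕ → ℚ
NA m n k = ((+ suc m) / (suc (suc n))) * ℕtoℚ ((n + 2) C (k + 1)) * ℕtoℚ ((n ∸ m) C k)

-- The matrix [NA_⟨m⟩(n+k,k)]_{n ≥ m, k ≥ 0}, with rows re-indexed by a = n - m ≥ 0,
-- i.e. row a is the row n = m + a.
NAsq : ℕ → ℕ → ℕ → ℚ
NAsq m a k = NA m ((m + a) + k) k

{-# OPTIONS --safe #-}

-- Positive row and column factors reduce the matrix to (a + k)! (a + k + m + 1)!,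
-- and then, after removing k! (k + m + 1)!, to p_{2a}(k), where
-- p_j(x) = (x + α₀) ⋯ (x + α_{j-1}) with α = 1, m + 2, 2, m + 3, 3, m + 4, ….
-- Fix the nodes x₀ < ⋯ < x_r of a minor and interpolate between the Newton basis at
-- these nodes and the p_j: at stage t, the j-th polynomial is the product of the first
-- j terms of x + α₀, …, x + α_{t-1}, x - x₀, x - x₁, ….  In the Newton basis a maximal
-- minor is triangular with positive diagonal or has a zero row.  Passing from stage t to
-- t + 1 adds to the j-th polynomial a nonnegative multiple of its predecessor, strictly
-- positive once j > t.  By multilinearity minors stay nonnegative, and those whose i-th
-- degree is at most i + t are positive at stage t; finally take t large.

module Submission where

open import Defs
open import Algebra.Bundles using (CommutativeRing)
import Algebra.Properties.Semiring.Sum as SemiringSum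
open import Data.Fin as Fin using (Fin; zero; suc; toℕ; fromℕ; fromℕ<; inject₁; punchIn)
open import Data.Fin.Properties
  using (any?; suc-injective; toℕ<n; toℕ-fromℕ<; toℕ-inject₁; toℕ-injective; ≤fromℕ)
import Data.Integer as ℤ
import Data.Integer.Properties as ℤ
open import Data.Nat as ℕ using (ℕ; zero; suc; z≤n; s≤s; z<s; s<s; _!; _∸_)
open import Data.Nat.Combinatorics using (_C_; nCk≡n!/k![n-k]!; k![n∸k]!∣n!)
import Data.Nat.DivMod as ℕ
import Data.Nat.Properties as ℕ
open import Data.Product using (_×_; _,_; proj₁; proj₂)
open import Data.Rational
  using (ℚ; 0ℚ; 1ℚ; _+_; _*_; -_; _-_; _/_; _<_; _≤_; positive; nonNegative; toℚᵘ)
import Data.Rational.Properties as ℚ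
open import Data.Rational.Solver using (module +-*-Solver)
open +-*-Solver using (solve; _:=_; _:+_; _:*_; _:-_; :-_; con)
open import Data.Rational.Unnormalised as ℚᵘ using (mkℚᵘ; *≡*; *<*)
import Data.Rational.Unnormalised.Properties as ℚᵘ
open import Data.Sum using (inj₁; inj₂)
open import Data.Vec.Functional using (updateAt)
open import Data.Vec.Functional.Properties using (updateAt-updates; updateAt-minimal)
open import Function using (_∘_; flip; const)
open import Relation.Binary.Definitions using (tri<; tri≈; tri>)
open import Relation.Binary.PropositionalEquality
open import Relation.Nullary using (yes; no; contradiction)

private
  module Sum = SemiringSum (CommutativeRing.semiring ℚ.+-*-commutativeRing)

Matrix : ℕ → Set
Matrix n = Fin n → Fin n → ℚ

-- Signs of sums and products of rationals.

pos*pos : ∀ {p q} → 0ℚ < p → 0ℚ < q → 0ℚ < p * q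
pos*pos {p} {q} 0<p 0<q =
  ℚ.positive⁻¹ (p * q) {{ℚ.pos*pos⇒pos p {{positive 0<p}} q {{positive 0<q}}}}

nonNeg*nonNeg : ∀ {p q} → 0ℚ ≤ p → 0ℚ ≤ q → 0ℚ ≤ p * q
nonNeg*nonNeg {p} {q} 0≤p 0≤q =
  ℚ.nonNegative⁻¹ (p * q)
    {{ℚ.nonNeg*nonNeg⇒nonNeg p {{nonNegative 0≤p}} q {{nonNegative 0≤q}}}}

pos+nonNeg : ∀ {p q} → 0ℚ < p → 0ℚ ≤ q → 0ℚ < p + q
pos+nonNeg 0<p 0≤q = ℚ.+-mono-<-≤ 0<p 0≤q

nonNeg+pos : ∀ {p q} → 0ℚ ≤ p → 0ℚ < q → 0ℚ < p + q
nonNeg+pos 0≤p 0<q = ℚ.+-mono-≤-< 0≤p 0<q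

-- Determinants

-- Gives access to the library's distributivity and interchange laws for finite sums.
∑≡sum : ∀ {n} (f : Fin n → ℚ) → ∑ f ≡ Sum.sum f
∑≡sum {zero}  f = refl
∑≡sum {suc n} f = cong (f zero +_) (∑≡sum (f ∘ suc))

∑-cong : ∀ {n} {f g : Fin n → ℚ} → (∀ i → f i ≡ g i) → ∑ f ≡ ∑ g
∑-cong {zero}  f≗g = refl
∑-cong {suc n} f≗g = cong₂ _+_ (f≗g zero) (∑-cong (f≗g ∘ suc))

∑-distrib-+ : ∀ {n} (f g : Fin n → ℚ) → ∑ (λ i → f i + g i) ≡ ∑ f + ∑ g
∑-distrib-+ f g = begin
  ∑ (λ i → f i + g i)        ≡⟨ ∑≡sum (λ i → f i + g i) ⟩
  Sum.sum (λ i → f i + g i)  ≡⟨ Sum.∑-distrib-+ f g ⟩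
  Sum.sum f + Sum.sum g      ≡⟨ cong₂ _+_ (∑≡sum f) (∑≡sum g) ⟨
  ∑ f + ∑ g                  ∎
  where open ≡-Reasoning

*-distribˡ-∑ : ∀ {n} c (f : Fin n → ℚ) → c * ∑ f ≡ ∑ (λ i → c * f i)
*-distribˡ-∑ c f = begin
  c * ∑ f                ≡⟨ cong (c *_) (∑≡sum f) ⟩
  c * Sum.sum f          ≡⟨ Sum.*-distribˡ-sum c f ⟩
  Sum.sum (λ i → c * f i) ≡⟨ ∑≡sum (λ i → c * f i) ⟨
  ∑ (λ i → c * f i)      ∎
  where open ≡-Reasoning

∑-zero : ∀ {n} {f : Fin n → ℚ} → (∀ i → f i ≡ 0ℚ) → ∑ f ≡ 0ℚ
∑-zero {zero}  f≗0 = refl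
∑-zero {suc n} f≗0 = cong₂ _+_ (f≗0 zero) (∑-zero (f≗0 ∘ suc))

∑-comm : ∀ {m n} (f : Fin m → Fin n → ℚ) →
         ∑ (λ i → ∑ (λ j → f i j)) ≡ ∑ (λ j → ∑ (λ i → f i j))
∑-comm f = begin
  ∑ (λ i → ∑ (f i))                  ≡⟨ ∑∑≡sumsum f ⟩
  Sum.sum (λ i → Sum.sum (f i))      ≡⟨ Sum.∑-comm f ⟩
  Sum.sum (λ j → Sum.sum (flip f j)) ≡⟨ ∑∑≡sumsum (flip f) ⟨
  ∑ (λ j → ∑ (flip f j))             ∎
  where
  open ≡-Reasoning
  ∑∑≡sumsum : ∀ {m n} (g : Fin m → Fin n → ℚ) →
              ∑ (λ i → ∑ (g i)) ≡ Sum.sum (λ i → Sum.sum (g i))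
  ∑∑≡sumsum g = trans (∑-cong (λ i → ∑≡sum (g i))) (∑≡sum (λ i → Sum.sum (g i)))

det-cong : ∀ {n} {A B : Matrix n} → (∀ i j → A i j ≡ B i j) → det A ≡ det B
det-cong {zero}  A≗B = refl
det-cong {suc n} A≗B = ∑-cong λ j →
  cong₂ _*_ (cong (sgn j *_) (A≗B zero j)) (det-cong λ i k → A≗B (suc i) (punchIn j k))

-- The top left term is common to both expansions. Every other minor along the first row still
-- contains the first column, so induction expands it there; the resulting double sum is symmetric
-- in the first row and the first column, and interchanging it gives the column expansion.
det-laplace-column : ∀ {n} (A : Matrix (suc n)) →
  det A ≡ ∑ (λ i → sgn i * A i zero * det (λ k l → A (punchIn i k) (suc l)))
det-laplace-column {zero}  A = refl
det-laplace-column {suc n} A = cong (1ℚ * A zero zero * det (λ k l → A (suc k) (suc l)) +_) (begin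
  ∑ (λ j → - sgn j * A zero (suc j) * det (λ k l → A (suc k) (punchIn (suc j) l)))
    ≡⟨ (∑-cong λ j → trans
         (cong (- sgn j * A zero (suc j) *_)
           (det-laplace-column (λ k l → A (suc k) (punchIn (suc j) l))))
         (*-distribˡ-∑ (- sgn j * A zero (suc j)) (λ i → sgn i * A (suc i) zero * minor i j))) ⟩
  ∑ (λ j → ∑ (λ i → - sgn j * A zero (suc j) * (sgn i * A (suc i) zero * minor i j)))
    ≡⟨ ∑-comm (λ j i → - sgn j * A zero (suc j) * (sgn i * A (suc i) zero * minor i j)) ⟩
  ∑ (λ i → ∑ (λ j → - sgn j * A zero (suc j) * (sgn i * A (suc i) zero * minor i j)))
    ≡⟨ (∑-cong λ i → ∑-cong λ j → exchange (sgn j) (A zero (suc j)) (sgn i) (A (suc i) zero) (minor i j)) ⟩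
  ∑ (λ i → ∑ (λ j → - sgn i * A (suc i) zero * (sgn j * A zero (suc j) * minor i j)))
    ≡⟨ (∑-cong λ i → *-distribˡ-∑ (- sgn i * A (suc i) zero) (λ j → sgn j * A zero (suc j) * minor i j)) ⟨
  ∑ (λ i → - sgn i * A (suc i) zero * det (λ k l → A (punchIn (suc i) k) (suc l))) ∎)
  where
  open ≡-Reasoning
  minor : Fin (suc n) → Fin (suc n) → ℚ
  minor i j = det (λ k l → A (suc (punchIn i k)) (suc (punchIn j l)))
  exchange : ∀ s a t b d → - s * a * (t * b * d) ≡ - t * b * (s * a * d)
  exchange = solve 5 (λ s a t b d → :- s :* a :* (t :* b :* d) := :- t :* b :* (s :* a :* d)) refl

-- The row expansion of the transpose is the column expansion of the original, once the smaller
-- minors are transposed by induction.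
det-transpose : ∀ {n} (A : Matrix n) → det (flip A) ≡ det A
det-transpose {zero}  A = refl
det-transpose {suc n} A = begin
  ∑ (λ i → sgn i * A i zero * det (flip (λ k l → A (punchIn i k) (suc l))))
    ≡⟨ (∑-cong λ i → cong (sgn i * A i zero *_) (det-transpose (λ k l → A (punchIn i k) (suc l)))) ⟩
  ∑ (λ i → sgn i * A i zero * det (λ k l → A (punchIn i k) (suc l)))
    ≡⟨ det-laplace-column A ⟨
  det A ∎
  where open ≡-Reasoning

-- Multilinearity, phrased by entrywise agreement of three matrices rather than by a row replacement
-- operator. In the first row the expansion itself splits; in a later row each of its minors splits
-- by induction.
det-row-linear : ∀ {n} (i : Fin n) {A B D : Matrix n} c →
  (∀ j → A i j ≡ B i j + c * D i j) →
  (∀ k → k ≢ i → ∀ j → A k j ≡ B k j × A k j ≡ D k j) →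
  det A ≡ det B + c * det D
det-row-linear {suc n} zero {A} {B} {D} c row rest = begin
  ∑ (λ j → sgn j * A zero j * minor A j)
    ≡⟨ (∑-cong λ j → begin
      sgn j * A zero j * minor A j
        ≡⟨ cong (λ a → sgn j * a * minor A j) (row j) ⟩
      sgn j * (B zero j + c * D zero j) * minor A j
        ≡⟨ expand (sgn j) (B zero j) c (D zero j) (minor A j) ⟩
      sgn j * B zero j * minor A j + c * (sgn j * D zero j * minor A j)
        ≡⟨ cong₂ (λ b d → sgn j * B zero j * b + c * (sgn j * D zero j * d))
             (det-cong λ k l → proj₁ (rest (suc k) (λ ()) (punchIn j l)))
             (det-cong λ k l → proj₂ (rest (suc k) (λ ()) (punchIn j l))) ⟩
      sgn j * B zero j * minor B j + c * (sgn j * D zero j * minor D j) ∎) ⟩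
  ∑ (λ j → sgn j * B zero j * minor B j + c * (sgn j * D zero j * minor D j))
    ≡⟨ ∑-distrib-+ (λ j → sgn j * B zero j * minor B j) (λ j → c * (sgn j * D zero j * minor D j)) ⟩
  det B + ∑ (λ j → c * (sgn j * D zero j * minor D j))
    ≡⟨ cong (det B +_) (*-distribˡ-∑ c (λ j → sgn j * D zero j * minor D j)) ⟨
  det B + c * det D ∎
  where
  open ≡-Reasoning
  minor : Matrix (suc n) → Fin (suc n) → ℚ
  minor M j = det (λ k l → M (suc k) (punchIn j l))
  expand : ∀ s b c d m → s * (b + c * d) * m ≡ s * b * m + c * (s * d * m)
  expand = solve 5 (λ s b c d m →
    s :* (b :+ c :* d) :* m := s :* b :* m :+ c :* (s :* d :* m)) refl
det-row-linear {suc n} (suc i) {A} {B} {D} c row rest = begin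
  ∑ (λ j → sgn j * A zero j * minor A j)
    ≡⟨ (∑-cong λ j → begin
      sgn j * A zero j * minor A j
        ≡⟨ cong (sgn j * A zero j *_) (det-row-linear i c (row ∘ punchIn j)
             (λ k k≢i l → rest (suc k) (k≢i ∘ suc-injective) (punchIn j l))) ⟩
      sgn j * A zero j * (minor B j + c * minor D j)
        ≡⟨ expand (sgn j) (A zero j) (minor B j) c (minor D j) ⟩
      sgn j * A zero j * minor B j + c * (sgn j * A zero j * minor D j)
        ≡⟨ cong₂ (λ a b → sgn j * a * minor B j + c * (sgn j * b * minor D j))
             (proj₁ (rest zero (λ ()) j)) (proj₂ (rest zero (λ ()) j)) ⟩
      sgn j * B zero j * minor B j + c * (sgn j * D zero j * minor D j) ∎) ⟩
  ∑ (λ j → sgn j * B zero j * minor B j + c * (sgn j * D zero j * minor D j))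
    ≡⟨ ∑-distrib-+ (λ j → sgn j * B zero j * minor B j) (λ j → c * (sgn j * D zero j * minor D j)) ⟩
  det B + ∑ (λ j → c * (sgn j * D zero j * minor D j))
    ≡⟨ cong (det B +_) (*-distribˡ-∑ c (λ j → sgn j * D zero j * minor D j)) ⟨
  det B + c * det D ∎
  where
  open ≡-Reasoning
  minor : Matrix (suc n) → Fin (suc n) → ℚ
  minor M j = det (λ k l → M (suc k) (punchIn j l))
  expand : ∀ s a b c d → s * a * (b + c * d) ≡ s * a * b + c * (s * a * d)
  expand = solve 5 (λ s a b c d →
    s :* a :* (b :+ c :* d) := s :* a :* b :+ c :* (s :* a :* d)) refl

-- A zero row satisfies `a ≡ a + - 1ℚ * a`, so linearity with `A` in all three roles gives det A =
-- det A - det A.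
det-zero-row : ∀ {n} (A : Matrix n) i → (∀ j → A i j ≡ 0ℚ) → det A ≡ 0ℚ
det-zero-row A i Ai≗0 = begin
  det A                   ≡⟨ det-row-linear i {A} {A} {A} (- 1ℚ)
                               (λ j → subst (λ a → a ≡ a + - 1ℚ * a) (sym (Ai≗0 j)) refl)
                               (λ _ _ _ → refl , refl) ⟩
  det A + - 1ℚ * det A    ≡⟨ solve 1 (λ x → x :+ con (- 1ℚ) :* x := con 0ℚ) refl (det A) ⟩
  0ℚ                      ∎
  where open ≡-Reasoning

-- The first two terms of the expansion have the same minor and opposite signs; each later minor
-- keeps both equal columns and vanishes by induction.
det-equal-first-columns : ∀ {n} (A : Matrix (suc (suc n))) →
  (∀ i → A i zero ≡ A i (suc zero)) → det A ≡ 0ℚ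
det-equal-first-columns {n} A eq = begin
  1ℚ * A zero zero * minor zero + (- 1ℚ * A zero (suc zero) * minor (suc zero) + ∑ later)
    ≡⟨ cong₂ (λ a d → 1ℚ * a * d + (- 1ℚ * A zero (suc zero) * minor (suc zero) + ∑ later))
         (eq zero) (det-cong minors-agree) ⟩
  1ℚ * A zero (suc zero) * minor (suc zero) + (- 1ℚ * A zero (suc zero) * minor (suc zero) + ∑ later)
    ≡⟨ cancel (A zero (suc zero)) (minor (suc zero)) (∑ later) ⟩
  ∑ later
    ≡⟨ ∑-zero (λ j → trans (cong (sgn (suc (suc j)) * A zero (suc (suc j)) *_) (later-minor n A eq j))
                           (ℚ.*-zeroʳ (sgn (suc (suc j)) * A zero (suc (suc j))))) ⟩
  0ℚ ∎
  where
  open ≡-Reasoning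
  minor : Fin (suc (suc n)) → ℚ
  minor j = det (λ k l → A (suc k) (punchIn j l))
  later : Fin n → ℚ
  later j = sgn (suc (suc j)) * A zero (suc (suc j)) * minor (suc (suc j))
  minors-agree : ∀ k l → A (suc k) (suc l) ≡ A (suc k) (punchIn (suc zero) l)
  minors-agree k zero    = sym (eq (suc k))
  minors-agree k (suc l) = refl
  cancel : ∀ a d s → 1ℚ * a * d + (- 1ℚ * a * d + s) ≡ s
  cancel = solve 3 (λ a d s →
    con 1ℚ :* a :* d :+ (con (- 1ℚ) :* a :* d :+ s) := s) refl
  -- Quantified over its own `n`, so that matching on it shows the minor to have at least two
  -- columns.
  later-minor : ∀ n (A : Matrix (suc (suc n))) → (∀ i → A i zero ≡ A i (suc zero)) →
    (j : Fin n) → det (λ k l → A (suc k) (punchIn (suc (suc j)) l)) ≡ 0ℚ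
  later-minor (suc n) A eq j =
    det-equal-first-columns (λ k l → A (suc k) (punchIn (suc (suc j)) l)) (eq ∘ suc)

-- If the pair is at the top, transposing reduces to columns; otherwise both rows survive in every
-- minor of the expansion. Adjacency suffices below: lowering one term of a strictly increasing
-- sequence by one can only make it meet its predecessor.
det-equal-adjacent-rows : ∀ {n} (A : Matrix (suc n)) (q : Fin n) →
  (∀ j → A (inject₁ q) j ≡ A (suc q) j) → det A ≡ 0ℚ
det-equal-adjacent-rows {suc n} A zero eq =
  trans (sym (det-transpose A)) (det-equal-first-columns (flip A) eq)
det-equal-adjacent-rows {suc n} A (suc q) eq = ∑-zero λ j →
  trans (cong (sgn j * A zero j *_)
          (det-equal-adjacent-rows (λ k l → A (suc k) (punchIn j l)) q (eq ∘ punchIn j)))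
        (ℚ.*-zeroʳ (sgn j * A zero j))

det-lower-triangular-pos : ∀ {n} (A : Matrix n) → (∀ i → 0ℚ < A i i) →
  (∀ {i j} → i Fin.< j → A i j ≡ 0ℚ) → 0ℚ < det A
det-lower-triangular-pos {zero}  A diag upper = ℚ.positive⁻¹ 1ℚ
det-lower-triangular-pos {suc n} A diag upper = subst (0ℚ <_) (sym (begin
  1ℚ * A zero zero * d + ∑ (λ j → - sgn j * A zero (suc j) * minor j)
    ≡⟨ cong (1ℚ * A zero zero * d +_) (∑-zero λ j →
         trans (cong (λ a → - sgn j * a * minor j) (upper z<s))
               (solve 2 (λ s m → :- s :* con 0ℚ :* m := con 0ℚ) refl (sgn j) (minor j))) ⟩
  1ℚ * A zero zero * d + 0ℚ
    ≡⟨ solve 2 (λ a d → con 1ℚ :* a :* d :+ con 0ℚ := a :* d) refl (A zero zero) d ⟩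
  A zero zero * d ∎))
  (pos*pos (diag zero)
    (det-lower-triangular-pos (λ i j → A (suc i) (suc j)) (diag ∘ suc) (upper ∘ s<s)))
  where
  open ≡-Reasoning
  d : ℚ
  d = det (λ i j → A (suc i) (suc j))
  minor : Fin n → ℚ
  minor j = det (λ k l → A (suc k) (punchIn (suc j) l))

-- Scaling rows and columns of a determinant.

∏ : ∀ {n} → (Fin n → ℚ) → ℚ
∏ {zero}  f = 1ℚ
∏ {suc n} f = f zero * ∏ (f ∘ suc)

∏-pos : ∀ {n} {f : Fin n → ℚ} → (∀ i → 0ℚ < f i) → 0ℚ < ∏ f
∏-pos {zero}  0<f = ℚ.positive⁻¹ 1ℚ
∏-pos {suc n} 0<f = pos*pos (0<f zero) (∏-pos (0<f ∘ suc))

det-scale-rows : ∀ {n} (u : Fin n → ℚ) (A : Matrix n) →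
  det (λ i j → u i * A i j) ≡ ∏ u * det A
det-scale-rows {zero}  u A = refl
det-scale-rows {suc n} u A = begin
  ∑ (λ j → sgn j * (u zero * A zero j) * det (λ k l → u (suc k) * A (suc k) (punchIn j l)))
    ≡⟨ (∑-cong λ j → trans
         (cong (sgn j * (u zero * A zero j) *_) (det-scale-rows (u ∘ suc) (λ k l → A (suc k) (punchIn j l))))
         (collect (sgn j) (u zero) (A zero j) (∏ (u ∘ suc)) (det (λ k l → A (suc k) (punchIn j l))))) ⟩
  ∑ (λ j → ∏ u * (sgn j * A zero j * det (λ k l → A (suc k) (punchIn j l))))
    ≡⟨ *-distribˡ-∑ (∏ u) (λ j → sgn j * A zero j * det (λ k l → A (suc k) (punchIn j l))) ⟨
  ∏ u * det A ∎
  where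
  open ≡-Reasoning
  collect : ∀ s u a p d → s * (u * a) * (p * d) ≡ u * p * (s * a * d)
  collect = solve 5 (λ s u a p d → s :* (u :* a) :* (p :* d) := u :* p :* (s :* a :* d)) refl

det-scale-columns : ∀ {n} (v : Fin n → ℚ) (A : Matrix n) →
  det (λ i j → v j * A i j) ≡ ∏ v * det A
det-scale-columns v A = begin
  det (λ i j → v j * A i j)       ≡⟨ det-transpose (λ i j → v j * A i j) ⟨
  det (λ j i → v j * A i j)       ≡⟨ det-scale-rows v (flip A) ⟩
  ∏ v * det (flip A)              ≡⟨ cong (∏ v *_) (det-transpose A) ⟩
  ∏ v * det A                     ∎
  where open ≡-Reasoning

-- Bidiagonal row operations

-- Here `p` is an infinite family of rows over `n` fixed columns, and `J` selects a maximal minor.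
-- The band `J i ≤ i + t` widens by one with each bidiagonal step; at `t = 0` it admits only the
-- rows 0, ..., n - 1.
PositiveUpTo : ∀ {n} → ℕ → (ℕ → Fin n → ℚ) → Set
PositiveUpTo {n} t p = ∀ (J : Fin n → ℕ) → StrictlyIncreasing J →
  0ℚ ≤ det (λ i → p (J i)) ×
  ((∀ i → J i ℕ.≤ toℕ i ℕ.+ t) → 0ℚ < det (λ i → p (J i)))

-- The rows `p′` arise from `p` by a lower bidiagonal matrix with unit diagonal and subdiagonal `c`.
module BidiagonalStep {r} (p p′ : ℕ → Fin (suc r) → ℚ) (c : ℕ → ℚ) (t : ℕ)
  (p′-zero : ∀ x → p′ zero x ≡ p zero x)
  (p′-suc : ∀ j x → p′ (suc j) x ≡ p (suc j) x + c j * p j x)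
  (c-nonNeg : ∀ j → 0ℚ ≤ c j)
  (c-pos : ∀ j → t ℕ.≤ j → 0ℚ < c j)
  where

  -- Lowering `s` from `suc r` to 0 converts the rows of a minor from `p` to `p′` one at a time,
  -- last row first. In this order the predecessor of the row being converted still comes from `p`,
  -- which is what makes `collision` produce two equal rows.
  mixed : ℕ → Fin (suc r) → ℕ → Fin (suc r) → ℚ
  mixed s i with toℕ i ℕ.<? s
  ... | yes _ = p
  ... | no  _ = p′

  mixed-< : ∀ {s i} → toℕ i ℕ.< s → mixed s i ≡ p
  mixed-< {s} {i} i<s with toℕ i ℕ.<? s
  ... | yes _   = refl
  ... | no  i≮s = contradiction i<s i≮s

  mixed-≥ : ∀ {s i} → s ℕ.≤ toℕ i → mixed s i ≡ p′
  mixed-≥ {s} {i} s≤i with toℕ i ℕ.<? s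
  ... | yes i<s = contradiction i<s (ℕ.≤⇒≯ s≤i)
  ... | no  _   = refl

  mixed-≢ : ∀ {i l} → l ≢ i → mixed (toℕ i) l ≡ mixed (suc (toℕ i)) l
  mixed-≢ {i} {l} l≢i with ℕ.<-cmp (toℕ l) (toℕ i)
  ... | tri< l<i _ _ = trans (mixed-< l<i) (sym (mixed-< (ℕ.m<n⇒m<1+n l<i)))
  ... | tri≈ _ l≡i _ = contradiction (toℕ-injective l≡i) l≢i
  ... | tri> _ _ i<l = trans (mixed-≥ (ℕ.<⇒≤ i<l)) (sym (mixed-≥ i<l))

  mixedDet : ℕ → (Fin (suc r) → ℕ) → ℚ
  mixedDet s J = det (λ i → mixed s i (J i))

  -- Rows still from `p` obey the old band, converted rows the wider one, so the condition
  -- interpolates between the hypothesis at `t` and the goal at `suc t`.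
  MixedPositive : ℕ → Set
  MixedPositive s = ∀ J → StrictlyIncreasing J →
    0ℚ ≤ mixedDet s J ×
    ((∀ i → toℕ i ℕ.< s → J i ℕ.≤ toℕ i ℕ.+ t) →
     (∀ i → s ℕ.≤ toℕ i → J i ℕ.≤ toℕ i ℕ.+ suc t) → 0ℚ < mixedDet s J)

  module _ (i : Fin (suc r)) (ih : MixedPositive (suc (toℕ i)))
           (J : Fin (suc r) → ℕ) (J↗ : StrictlyIncreasing J) where

    private s = toℕ i

    unchanged : J i ≡ 0 → mixedDet s J ≡ mixedDet (suc s) J
    unchanged Ji≡0 = det-cong entries
      where
      open ≡-Reasoning
      entries : ∀ l x → mixed s l (J l) x ≡ mixed (suc s) l (J l) x
      entries l x with l Fin.≟ i
      ... | no  l≢i  = cong (λ q → q (J l) x) (mixed-≢ l≢i)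
      ... | yes refl = begin
        mixed s l (J l) x        ≡⟨ cong₂ (λ q j → q j x) (mixed-≥ {s} {l} ℕ.≤-refl) Ji≡0 ⟩
        p′ 0 x                   ≡⟨ p′-zero x ⟩
        p 0 x                    ≡⟨ cong₂ (λ q j → q j x) (mixed-< {suc s} {l} ℕ.≤-refl) Ji≡0 ⟨
        mixed (suc s) l (J l) x  ∎

    module _ (k : ℕ) (Ji≡1+k : J i ≡ suc k) where

      J⁻ : Fin (suc r) → ℕ
      J⁻ = updateAt J i (const k)

      J⁻-at : J⁻ i ≡ k
      J⁻-at = updateAt-updates i J

      J⁻-off : ∀ {l} → l ≢ i → J⁻ l ≡ J l
      J⁻-off {l} l≢i = updateAt-minimal l i J l≢i

      J⁻-increasing : (∀ l → l Fin.< i → J l ℕ.< k) → StrictlyIncreasing J⁻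
      J⁻-increasing below a b a<b with a Fin.≟ i | b Fin.≟ i
      ... | yes refl | yes refl = contradiction a<b (ℕ.<-irrefl refl)
      ... | yes refl | no  b≢i  = subst₂ ℕ._<_ (sym J⁻-at) (sym (J⁻-off b≢i))
        (ℕ.<-trans (ℕ.n<1+n k) (subst (ℕ._< J b) Ji≡1+k (J↗ a b a<b)))
      ... | no  a≢i  | yes refl = subst₂ ℕ._<_ (sym (J⁻-off a≢i)) (sym J⁻-at) (below a a<b)
      ... | no  a≢i  | no  b≢i  = subst₂ ℕ._<_ (sym (J⁻-off a≢i)) (sym (J⁻-off b≢i)) (J↗ a b a<b)

      -- Linearity in row `i`, where `p′ (suc k)` is `p (suc k)` plus `c k` times `p k`.
      split : mixedDet s J ≡ mixedDet (suc s) J + c k * mixedDet (suc s) J⁻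
      split = det-row-linear i (c k) row λ l l≢i x →
        cong (λ q → q (J l) x) (mixed-≢ l≢i) ,
        cong₂ (λ q j → q j x) (mixed-≢ l≢i) (sym (J⁻-off l≢i))
        where
        open ≡-Reasoning
        row : ∀ x → mixed s i (J i) x ≡ mixed (suc s) i (J i) x + c k * mixed (suc s) i (J⁻ i) x
        row x = begin
          mixed s i (J i) x        ≡⟨ cong₂ (λ q j → q j x) (mixed-≥ {s} {i} ℕ.≤-refl) Ji≡1+k ⟩
          p′ (suc k) x             ≡⟨ p′-suc k x ⟩
          p (suc k) x + c k * p k x
            ≡⟨ cong₂ (λ q j → q j x + c k * p k x) (mixed-< {suc s} {i} ℕ.≤-refl) Ji≡1+k ⟨
          mixed (suc s) i (J i) x + c k * p k x
            ≡⟨ cong₂ (λ q j → mixed (suc s) i (J i) x + c k * q j x) (mixed-< {suc s} {i} ℕ.≤-refl) J⁻-at ⟨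
          mixed (suc s) i (J i) x + c k * mixed (suc s) i (J⁻ i) x ∎

      collision : ∀ q → i ≡ suc q → J (inject₁ q) ≡ k → mixedDet (suc s) J⁻ ≡ 0ℚ
      collision q refl Jq≡k =
        det-equal-adjacent-rows (λ l → mixed (suc s) l (J⁻ l)) q λ x →
          cong₂ (λ f j → f j x)
            (trans (mixed-< (ℕ.m<n⇒m<1+n q<i)) (sym (mixed-< {suc s} {suc q} ℕ.≤-refl)))
            (trans (J⁻-off (λ q≡i → ℕ.<⇒≢ q<i (cong toℕ q≡i))) (trans Jq≡k (sym J⁻-at)))
        where
        q<i : toℕ (inject₁ q) ℕ.< suc (toℕ q)
        q<i = s≤s (ℕ.≤-reflexive (toℕ-inject₁ q))

      -- Either the lowered sequence is still strictly increasing and the induction hypothesis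
      -- applies, or the predecessor already has index `k` and the determinant is zero.
      lowered-nonNeg : 0ℚ ≤ mixedDet (suc s) J⁻
      lowered-nonNeg = byPredecessor i refl
        where
        byPredecessor : ∀ l → i ≡ l → 0ℚ ≤ mixedDet (suc s) J⁻
        byPredecessor zero    refl = proj₁ (ih J⁻ (J⁻-increasing λ _ ()))
        byPredecessor (suc q) refl with J (inject₁ q) ℕ.<? k
        ... | no  Jq≮k = ℚ.≤-reflexive (sym (collision q refl
                (ℕ.≤-antisym (ℕ.≤-pred (subst (J (inject₁ q) ℕ.<_) Ji≡1+k (J↗ _ _ (s≤s (ℕ.≤-reflexive (toℕ-inject₁ q))))))
                             (ℕ.≮⇒≥ Jq≮k))))
        ... | yes Jq<k = proj₁ (ih J⁻ (J⁻-increasing λ l l<i → below l (ℕ.≤-pred l<i)))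
          where
          below : ∀ l → toℕ l ℕ.≤ toℕ q → J l ℕ.< k
          below l l≤q with ℕ.m≤n⇒m<n∨m≡n l≤q
          ... | inj₁ l<q = ℕ.<-trans (J↗ l (inject₁ q) (subst (toℕ l ℕ.<_) (sym (toℕ-inject₁ q)) l<q)) Jq<k
          ... | inj₂ l≡q = subst (λ m → J m ℕ.< k)
                  (toℕ-injective (trans (toℕ-inject₁ q) (sym l≡q))) Jq<k

      nonNeg : 0ℚ ≤ mixedDet s J
      nonNeg = subst (0ℚ ≤_) (sym split)
        (ℚ.+-mono-≤ (proj₁ (ih J J↗)) (nonNeg*nonNeg (c-nonNeg k) lowered-nonNeg))

      pos : (∀ l → toℕ l ℕ.< s → J l ℕ.≤ toℕ l ℕ.+ t) →
            (∀ l → s ℕ.≤ toℕ l → J l ℕ.≤ toℕ l ℕ.+ suc t) → 0ℚ < mixedDet s J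
      pos low high = subst (0ℚ <_) (sym split) pos′
        where
        pos′ : 0ℚ < mixedDet (suc s) J + c k * mixedDet (suc s) J⁻
        -- Strictly inside the wide band, `J` already obeys the old bound at `i` and the first
        -- summand is positive. On its edge `k` equals `s + t`, so `c k` is positive and the lowered
        -- sequence obeys the old bound: the second summand is positive.
        pos′ with ℕ.m≤n⇒m<n∨m≡n (high i ℕ.≤-refl)
        ... | inj₁ Ji<s+1+t =
          pos+nonNeg (proj₂ (ih J J↗) low′ (λ l s<l → high l (ℕ.<⇒≤ s<l)))
                     (nonNeg*nonNeg (c-nonNeg k) lowered-nonNeg)
          where
          low′ : ∀ l → toℕ l ℕ.< suc s → J l ℕ.≤ toℕ l ℕ.+ t
          low′ l l<1+s with l Fin.≟ i
          ... | yes refl = ℕ.≤-pred (subst (J l ℕ.<_) (ℕ.+-suc (toℕ l) t) Ji<s+1+t)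
          ... | no  l≢i  = low l (ℕ.≤∧≢⇒< (ℕ.≤-pred l<1+s) (l≢i ∘ toℕ-injective))
        ... | inj₂ Ji≡s+1+t =
          nonNeg+pos (proj₁ (ih J J↗))
            (pos*pos (c-pos k (subst (t ℕ.≤_) (sym k≡s+t) (ℕ.m≤n+m t s)))
              (proj₂ (ih J⁻ (J⁻-increasing below)) low′ high′))
          where
          k≡s+t : k ≡ s ℕ.+ t
          k≡s+t = ℕ.suc-injective (trans (sym Ji≡1+k) (trans Ji≡s+1+t (ℕ.+-suc s t)))
          -- No collision on the edge: earlier terms satisfy J l ≤ l + t < s + t = k.
          below : ∀ l → l Fin.< i → J l ℕ.< k
          below l l<i = subst (J l ℕ.<_) (sym k≡s+t) (ℕ.≤-<-trans (low l l<i) (ℕ.+-monoˡ-< t l<i))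
          low′ : ∀ l → toℕ l ℕ.< suc s → J⁻ l ℕ.≤ toℕ l ℕ.+ t
          low′ l l<1+s with l Fin.≟ i
          ... | yes refl = ℕ.≤-reflexive (trans J⁻-at k≡s+t)
          ... | no  l≢i  = subst (ℕ._≤ toℕ l ℕ.+ t) (sym (J⁻-off l≢i))
                  (low l (ℕ.≤∧≢⇒< (ℕ.≤-pred l<1+s) (l≢i ∘ toℕ-injective)))
          high′ : ∀ l → suc s ℕ.≤ toℕ l → J⁻ l ℕ.≤ toℕ l ℕ.+ suc t
          high′ l s<l = subst (ℕ._≤ toℕ l ℕ.+ suc t)
            (sym (J⁻-off (λ l≡i → ℕ.<⇒≢ s<l (cong toℕ (sym l≡i))))) (high l (ℕ.<⇒≤ s<l))

  mixed-step : ∀ i → MixedPositive (suc (toℕ i)) → MixedPositive (toℕ i)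
  mixed-step i ih J J↗ with J i in Ji≡
  ... | suc k = nonNeg i ih J J↗ k Ji≡ , pos i ih J J↗ k Ji≡
  ... | zero  = subst (0ℚ ≤_) (sym same) (proj₁ (ih J J↗)) , λ low high →
      subst (0ℚ <_) (sym same) (proj₂ (ih J J↗) (low′ low) (λ l s<l → high l (ℕ.<⇒≤ s<l)))
    where
    same = unchanged i ih J J↗ Ji≡
    low′ : (∀ l → toℕ l ℕ.< toℕ i → J l ℕ.≤ toℕ l ℕ.+ t) →
           ∀ l → toℕ l ℕ.< suc (toℕ i) → J l ℕ.≤ toℕ l ℕ.+ t
    low′ low l l<1+s with l Fin.≟ i
    ... | yes refl = subst (ℕ._≤ toℕ l ℕ.+ t) (sym Ji≡) z≤n
    ... | no  l≢i  = low l (ℕ.≤∧≢⇒< (ℕ.≤-pred l<1+s) (l≢i ∘ toℕ-injective))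

  mixed-descend : ∀ s → s ℕ.≤ suc r → MixedPositive s → MixedPositive 0
  mixed-descend zero    _   h = h
  mixed-descend (suc s) s<n h = mixed-descend s (ℕ.<⇒≤ s<n)
    (subst MixedPositive (toℕ-fromℕ< s<n)
      (mixed-step (fromℕ< s<n) (subst (MixedPositive ∘ suc) (sym (toℕ-fromℕ< s<n)) h)))

  bidiagonal-step : PositiveUpTo t p → PositiveUpTo (suc t) p′
  bidiagonal-step h J J↗ =
    let h′ = mixed-descend (suc r) ℕ.≤-refl unmixed J J↗
    in  subst (0ℚ ≤_) all-p′ (proj₁ h′) ,
        λ bound → subst (0ℚ <_) all-p′ (proj₂ h′ (λ _ ()) (λ i _ → bound i))
    where
    all-p′ : mixedDet 0 J ≡ det (λ i → p′ (J i))
    all-p′ = det-cong λ i x → cong (λ q → q (J i) x) (mixed-≥ {0} {i} z≤n)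
    unmixed : MixedPositive (suc r)
    unmixed K K↗ =
      subst (0ℚ ≤_) all-p (proj₁ (h K K↗)) ,
      λ low _ → subst (0ℚ <_) all-p (proj₂ (h K K↗) (λ i → low i (toℕ<n i)))
      where
      all-p : det (λ i → p (K i)) ≡ mixedDet (suc r) K
      all-p = det-cong λ i x → cong (λ q → q (K i) x) (sym (mixed-< (toℕ<n i)))

-- Bounds for strictly increasing index sequences.

i≤J[i] : ∀ {n} {J : Fin n → ℕ} → StrictlyIncreasing J → ∀ i → toℕ i ℕ.≤ J i
i≤J[i] J↗ zero    = z≤n
i≤J[i] {J = J} J↗ (suc i) = ℕ.≤-<-trans (i≤J[i] {J = J ∘ inject₁} restricted i)
  (J↗ (inject₁ i) (suc i) (s≤s (ℕ.≤-reflexive (toℕ-inject₁ i))))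
  where
  restricted : StrictlyIncreasing (J ∘ inject₁)
  restricted a b a<b = J↗ (inject₁ a) (inject₁ b)
    (subst₂ ℕ._<_ (sym (toℕ-inject₁ a)) (sym (toℕ-inject₁ b)) a<b)

-- Each step back from the last term loses at least one. The induction drops the first term, which
-- shortens the sequence and raises the offset to `suc b`.
J[i]≤i+b : ∀ {n} {J : Fin n → ℕ} b → StrictlyIncreasing J →
           (∀ i → J i ℕ.< n ℕ.+ b) → ∀ i → J i ℕ.≤ toℕ i ℕ.+ b
J[i]≤i+b {suc zero}        b J↗ J<n+b zero = ℕ.≤-pred (J<n+b zero)
J[i]≤i+b {suc (suc n)} {J} b J↗ J<n+b i    = bound i
  where
  tail-bound : ∀ i → J (suc i) ℕ.≤ toℕ i ℕ.+ suc b
  tail-bound = J[i]≤i+b (suc b) (λ k l k<l → J↗ (suc k) (suc l) (s<s k<l))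
    (λ k → subst (J (suc k) ℕ.<_) (sym (ℕ.+-suc (suc n) b)) (J<n+b (suc k)))
  bound : ∀ i → J i ℕ.≤ toℕ i ℕ.+ b
  bound zero    = ℕ.≤-pred (ℕ.<-≤-trans (J↗ zero (suc zero) z<s) (tail-bound zero))
  bound (suc i) = subst (J (suc i) ℕ.≤_) (ℕ.+-suc (toℕ i) b) (tail-bound i)

J≤J[last] : ∀ {r} {J : Fin (suc r) → ℕ} → StrictlyIncreasing J → ∀ i → J i ℕ.≤ J (fromℕ r)
J≤J[last] {r} {J} J↗ i with ℕ.m≤n⇒m<n∨m≡n (≤fromℕ i)
... | inj₁ i<last = ℕ.<⇒≤ (J↗ i (fromℕ r) i<last)
... | inj₂ i≡last = ℕ.≤-reflexive (cong J (toℕ-injective i≡last))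

0<q-p : ∀ {p q} → p < q → 0ℚ < q - p
0<q-p {p} {q} p<q = subst (_< q - p) (ℚ.+-inverseʳ p) (ℚ.+-monoˡ-< (- p) p<q)

-- Interpolation between the Newton basis and products of shifts

newton : (ℕ → ℚ) → ℕ → ℚ → ℚ
newton y zero    x = 1ℚ
newton y (suc j) x = (x - y j) * newton y j x

newton-vanishes : ∀ y {l j} → l ℕ.< j → newton y j (y l) ≡ 0ℚ
newton-vanishes y {l} {suc j} (s≤s l≤j) with ℕ.m≤n⇒m<n∨m≡n l≤j
... | inj₁ l<j  = trans (cong ((y l - y j) *_) (newton-vanishes y l<j)) (ℚ.*-zeroʳ (y l - y j))
... | inj₂ refl = trans (cong (_* newton y l (y l)) (ℚ.+-inverseʳ (y l))) (ℚ.*-zeroˡ (newton y l (y l)))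

newton-pos : ∀ y j {x} → (∀ {l} → l ℕ.< j → y l < x) → 0ℚ < newton y j x
newton-pos y zero    y<x = ℚ.positive⁻¹ 1ℚ
newton-pos y (suc j) y<x =
  pos*pos (0<q-p (y<x (ℕ.n<1+n j))) (newton-pos y j (λ l<j → y<x (ℕ.m<n⇒m<1+n l<j)))

-- Factors are peeled from the front, unlike in `newton`, so that `hybrid` can use up its shifts
-- first and end in a Newton polynomial.
shifted : (ℕ → ℚ) → ℕ → ℚ → ℚ
shifted α zero    x = 1ℚ
shifted α (suc j) x = (x + α zero) * shifted (α ∘ suc) j x

hybrid : (ℕ → ℚ) → (ℕ → ℚ) → ℕ → ℕ → ℚ → ℚ
hybrid y α zero    j       x = newton y j x
hybrid y α (suc t) zero    x = 1ℚ
hybrid y α (suc t) (suc j) x = (x + α zero) * hybrid y (α ∘ suc) t j x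

hybrid-zero : ∀ y α t x → hybrid y α t zero x ≡ 1ℚ
hybrid-zero y α zero    x = refl
hybrid-zero y α (suc t) x = refl

hybrid-≤ : ∀ y α {t j} x → j ℕ.≤ t → hybrid y α t j x ≡ shifted α j x
hybrid-≤ y α {t} x z≤n       = hybrid-zero y α t x
hybrid-≤ y α     x (s≤s j≤t) = cong ((x + α zero) *_) (hybrid-≤ y (α ∘ suc) x j≤t)

-- In closed form: α_t + y_{j-t} for j ≥ t, and 0 for j < t.
coefficient : (ℕ → ℚ) → (ℕ → ℚ) → ℕ → ℕ → ℚ
coefficient y α zero    j       = α zero + y j
coefficient y α (suc t) zero    = 0ℚ
coefficient y α (suc t) (suc j) = coefficient y (α ∘ suc) t j

-- For j ≥ t the two polynomials of degree j + 1 differ in one factor, x + α_t against x - y_{j-t};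
-- the difference of these factors is constant and the common cofactor is the polynomial of degree j
-- at stage t. For j < t they coincide.
hybrid-suc : ∀ y α t j x →
  hybrid y α (suc t) (suc j) x ≡ hybrid y α t (suc j) x + coefficient y α t j * hybrid y α t j x
hybrid-suc y α zero    j    x =
  solve 4 (λ x a b p → (x :+ a) :* p := (x :- b) :* p :+ (a :+ b) :* p) refl
    x (α zero) (y j) (newton y j x)
hybrid-suc y α (suc t) zero x = begin
  (x + α zero) * 1ℚ
    ≡⟨ cong ((x + α zero) *_) (hybrid-zero y (α ∘ suc) t x) ⟨
  (x + α zero) * hybrid y (α ∘ suc) t zero x
    ≡⟨ ℚ.+-identityʳ ((x + α zero) * hybrid y (α ∘ suc) t zero x) ⟨
  (x + α zero) * hybrid y (α ∘ suc) t zero x + 0ℚ * 1ℚ ∎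
  where open ≡-Reasoning
hybrid-suc y α (suc t) (suc j) x = begin
  (x + α zero) * hybrid y (α ∘ suc) (suc t) (suc j) x
    ≡⟨ cong ((x + α zero) *_) (hybrid-suc y (α ∘ suc) t j x) ⟩
  (x + α zero) * (h + c * h′)
    ≡⟨ solve 4 (λ f h c h′ → f :* (h :+ c :* h′) := f :* h :+ c :* (f :* h′)) refl
         (x + α zero) h c h′ ⟩
  (x + α zero) * h + c * ((x + α zero) * h′) ∎
  where
  open ≡-Reasoning
  h h′ c : ℚ
  h  = hybrid y (α ∘ suc) t (suc j) x
  h′ = hybrid y (α ∘ suc) t j x
  c  = coefficient y (α ∘ suc) t j

module _ (y : ℕ → ℚ) (y-nonNeg : ∀ l → 0ℚ ≤ y l) where

  coefficient-pos : ∀ {α} → (∀ l → 0ℚ < α l) → ∀ t j → t ℕ.≤ j → 0ℚ < coefficient y α t j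
  coefficient-pos α>0 zero    j       _         = pos+nonNeg (α>0 zero) (y-nonNeg j)
  coefficient-pos α>0 (suc t) (suc j) (s≤s t≤j) = coefficient-pos (α>0 ∘ suc) t j t≤j

  coefficient-nonNeg : ∀ {α} → (∀ l → 0ℚ < α l) → ∀ t j → 0ℚ ≤ coefficient y α t j
  coefficient-nonNeg α>0 zero    j       = ℚ.<⇒≤ (coefficient-pos α>0 zero j z≤n)
  coefficient-nonNeg α>0 (suc t) zero    = ℚ.≤-refl
  coefficient-nonNeg α>0 (suc t) (suc j) = coefficient-nonNeg (α>0 ∘ suc) t j

  -- Increase is asked of the r + 1 nodes of the minor; later terms of `y` continue the Newton basis
  -- and are merely nonnegative.
  module _ {r} (y↗ : ∀ {k l} → k ℕ.< l → l ℕ.< suc r → y k < y l) where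

    newton-positive : PositiveUpTo {suc r} 0 (λ j i → newton y j (y (toℕ i)))
    -- A degree of at least r + 1 gives a polynomial vanishing at all nodes. If there is none, the r
    -- + 1 increasing degrees must be 0, ..., r.
    newton-positive J J↗ with any? (λ i → suc r ℕ.≤? J i)
    ... | yes (i , n≤Ji) =
      ℚ.≤-reflexive (sym (det-zero-row (λ i j → newton y (J i) (y (toℕ j))) i
        (λ j → newton-vanishes y (ℕ.<-≤-trans (toℕ<n j) n≤Ji)))) ,
      λ J≤i → contradiction
        (ℕ.≤-trans n≤Ji (subst (J i ℕ.≤_) (ℕ.+-identityʳ (toℕ i)) (J≤i i))) (ℕ.<⇒≱ (toℕ<n i))
    ... | no ∄n≤J = ℚ.<⇒≤ det>0 , const det>0
      where
      J≡toℕ : ∀ i → J i ≡ toℕ i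
      J≡toℕ i = ℕ.≤-antisym
        (subst (J i ℕ.≤_) (ℕ.+-identityʳ (toℕ i)) (J[i]≤i+b 0 J↗
          (λ k → subst (J k ℕ.<_) (sym (ℕ.+-identityʳ (suc r))) (ℕ.≰⇒> (λ n≤Jk → ∄n≤J (k , n≤Jk)))) i))
        (i≤J[i] J↗ i)
      det>0 : 0ℚ < det (λ i j → newton y (J i) (y (toℕ j)))
      det>0 = subst (0ℚ <_) (det-transpose (λ i j → newton y (J i) (y (toℕ j))))
        (det-lower-triangular-pos (λ j i → newton y (J i) (y (toℕ j)))
          (λ i → newton-pos y (J i) (λ {l} l<Ji → y↗ (subst (l ℕ.<_) (J≡toℕ i) l<Ji) (toℕ<n i)))
          (λ {j} {i} j<i → newton-vanishes y (subst (toℕ j ℕ.<_) (sym (J≡toℕ i)) j<i)))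

    hybrid-positive : ∀ {α} → (∀ l → 0ℚ < α l) →
      ∀ t → PositiveUpTo {suc r} t (λ j i → hybrid y α t j (y (toℕ i)))
    hybrid-positive     α>0 zero    = newton-positive
    hybrid-positive {α} α>0 (suc t) = BidiagonalStep.bidiagonal-step
      (λ j i → hybrid y α t j (y (toℕ i))) (λ j i → hybrid y α (suc t) j (y (toℕ i)))
      (coefficient y α t) t
      (λ i → sym (hybrid-zero y α t (y (toℕ i))))
      (λ j i → hybrid-suc y α t j (y (toℕ i)))
      (coefficient-nonNeg α>0 t) (coefficient-pos α>0 t)
      (hybrid-positive α>0 t)

    shifted-minor-pos : ∀ {α} → (∀ l → 0ℚ < α l) → (J : Fin (suc r) → ℕ) → StrictlyIncreasing J →
      0ℚ < det (λ i j → shifted α (J i) (y (toℕ j)))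
    shifted-minor-pos {α} α>0 J J↗ = subst (0ℚ <_)
      (det-cong λ i j → hybrid-≤ y α (y (toℕ j)) (J≤J[last] J↗ i))
      (proj₂ (hybrid-positive α>0 t J J↗) (λ i → ℕ.≤-trans (J≤J[last] J↗ i) (ℕ.m≤n+m t (toℕ i))))
      where
      t : ℕ
      -- The largest degree: every selected hybrid is then a pure product of shifts, and the band
      -- condition holds trivially.
      t = J (fromℕ r)

-- Factorials and the Narayana entries

-- Rationals are stored in lowest terms, so this and the next identities are checked on unnormalised
-- fractions.
ℕtoℚ-homo-+ : ∀ a b → ℕtoℚ (a ℕ.+ b) ≡ ℕtoℚ a + ℕtoℚ b
ℕtoℚ-homo-+ a b = ℚ.toℚᵘ-injective (begin
  toℚᵘ (ℕtoℚ (a ℕ.+ b))            ≈⟨ ℚ.toℚᵘ-fromℚᵘ (mkℚᵘ (ℤ.+ (a ℕ.+ b)) 0) ⟩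
  mkℚᵘ (ℤ.+ (a ℕ.+ b)) 0             ≈⟨ *≡* (cong (ℤ._* ℤ.+ 1) (trans (ℤ.pos-+ a b)
                                        (sym (cong₂ ℤ._+_ (ℤ.*-identityʳ (ℤ.+ a)) (ℤ.*-identityʳ (ℤ.+ b)))))) ⟩
  mkℚᵘ (ℤ.+ a) 0 ℚᵘ.+ mkℚᵘ (ℤ.+ b) 0   ≈⟨ ℚᵘ.+-cong (ℚ.toℚᵘ-fromℚᵘ (mkℚᵘ (ℤ.+ a) 0)) (ℚ.toℚᵘ-fromℚᵘ (mkℚᵘ (ℤ.+ b) 0)) ⟨
  toℚᵘ (ℕtoℚ a) ℚᵘ.+ toℚᵘ (ℕtoℚ b) ≈⟨ ℚ.toℚᵘ-homo-+ (ℕtoℚ a) (ℕtoℚ b) ⟨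
  toℚᵘ (ℕtoℚ a + ℕtoℚ b)           ∎)
  where open ℚᵘ.≃-Reasoning

/-*-ℕtoℚ : ∀ a b d → (ℤ.+ a) / suc d * ℕtoℚ b ≡ (ℤ.+ (a ℕ.* b)) / suc d
/-*-ℕtoℚ a b d = ℚ.toℚᵘ-injective (begin
  toℚᵘ ((ℤ.+ a) / suc d * ℕtoℚ b)          ≈⟨ ℚ.toℚᵘ-homo-* ((ℤ.+ a) / suc d) (ℕtoℚ b) ⟩
  toℚᵘ ((ℤ.+ a) / suc d) ℚᵘ.* toℚᵘ (ℕtoℚ b) ≈⟨ ℚᵘ.*-cong (ℚ.toℚᵘ-fromℚᵘ (mkℚᵘ (ℤ.+ a) d)) (ℚ.toℚᵘ-fromℚᵘ (mkℚᵘ (ℤ.+ b) 0)) ⟩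
  mkℚᵘ (ℤ.+ a) d ℚᵘ.* mkℚᵘ (ℤ.+ b) 0         ≈⟨ *≡* (cong₂ ℤ._*_ (sym (ℤ.pos-* a b)) (cong (ℤ.+_ ∘ suc) (sym (ℕ.*-identityʳ d)))) ⟩
  mkℚᵘ (ℤ.+ (a ℕ.* b)) d                   ≈⟨ ℚ.toℚᵘ-fromℚᵘ (mkℚᵘ (ℤ.+ (a ℕ.* b)) d) ⟨
  toℚᵘ ((ℤ.+ (a ℕ.* b)) / suc d)           ∎)
  where open ℚᵘ.≃-Reasoning

ℕtoℚ-homo-* : ∀ a b → ℕtoℚ (a ℕ.* b) ≡ ℕtoℚ a * ℕtoℚ b
ℕtoℚ-homo-* a b = sym (/-*-ℕtoℚ a b 0)

/-cancel : ∀ a d → (ℤ.+ a) / suc d * ℕtoℚ (suc d) ≡ ℕtoℚ a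
/-cancel a d = trans (/-*-ℕtoℚ a (suc d) d) (ℚ.fromℚᵘ-cong {mkℚᵘ (ℤ.+ (a ℕ.* suc d)) d} {mkℚᵘ (ℤ.+ a) 0}
  (*≡* (trans (ℤ.*-identityʳ (ℤ.+ (a ℕ.* suc d))) (ℤ.pos-* a (suc d)))))

ℕtoℚ-mono-< : ∀ {a b} → a ℕ.< b → ℕtoℚ a < ℕtoℚ b
ℕtoℚ-mono-< {a} {b} a<b = ℚ.toℚᵘ-cancel-< (begin-strict
  toℚᵘ (ℕtoℚ a) ≃⟨ ℚ.toℚᵘ-fromℚᵘ (mkℚᵘ (ℤ.+ a) 0) ⟩
  mkℚᵘ (ℤ.+ a) 0  <⟨ *<* (subst₂ ℤ._<_ (sym (ℤ.*-identityʳ (ℤ.+ a))) (sym (ℤ.*-identityʳ (ℤ.+ b))) (ℤ.+<+ a<b)) ⟩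
  mkℚᵘ (ℤ.+ b) 0  ≃⟨ ℚ.toℚᵘ-fromℚᵘ (mkℚᵘ (ℤ.+ b) 0) ⟨
  toℚᵘ (ℕtoℚ b) ∎)
  where open ℚᵘ.≤-Reasoning

ℕtoℚ-nonNeg : ∀ a → 0ℚ ≤ ℕtoℚ a
ℕtoℚ-nonNeg zero    = ℚ.≤-refl
ℕtoℚ-nonNeg (suc a) = ℚ.<⇒≤ (ℕtoℚ-mono-< {0} {suc a} z<s)

infix 9 _!ℚ
_!ℚ : ℕ → ℚ
n !ℚ = ℕtoℚ (n !)

!ℚ-pos : ∀ n → 0ℚ < n !ℚ
!ℚ-pos n = ℕtoℚ-mono-< (ℕ.>-nonZero⁻¹ (n !) {{n ℕ.!≢0}})

-- Writing the upper index as `a + b` and clearing denominators spares later uses both division and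
-- truncated subtraction.
C-factorials : ∀ a b → ℕtoℚ ((a ℕ.+ b) C a) * (a !ℚ * b !ℚ) ≡ (a ℕ.+ b) !ℚ
C-factorials a b = begin
  ℕtoℚ ((a ℕ.+ b) C a) * (a !ℚ * b !ℚ)  ≡⟨ cong (ℕtoℚ ((a ℕ.+ b) C a) *_) (ℕtoℚ-homo-* (a !) (b !)) ⟨
  ℕtoℚ ((a ℕ.+ b) C a) * ℕtoℚ (a ! ℕ.* b !) ≡⟨ ℕtoℚ-homo-* ((a ℕ.+ b) C a) (a ! ℕ.* b !) ⟨
  ℕtoℚ (((a ℕ.+ b) C a) ℕ.* (a ! ℕ.* b !)) ≡⟨ cong ℕtoℚ inℕ ⟩
  (a ℕ.+ b) !ℚ ∎
  where
  open ≡-Reasoning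
  a≤a+b = ℕ.m≤m+n a b
  instance _ = a ℕ.!* (a ℕ.+ b ∸ a) !≢0
  inℕ : ((a ℕ.+ b) C a) ℕ.* (a ! ℕ.* b !) ≡ (a ℕ.+ b) !
  inℕ = begin
    ((a ℕ.+ b) C a) ℕ.* (a ! ℕ.* b !)
      ≡⟨ cong (λ m → ((a ℕ.+ b) C a) ℕ.* (a ! ℕ.* m !)) (ℕ.m+n∸m≡n a b) ⟨
    ((a ℕ.+ b) C a) ℕ.* (a ! ℕ.* (a ℕ.+ b ∸ a) !)
      ≡⟨ cong (ℕ._* (a ! ℕ.* (a ℕ.+ b ∸ a) !)) (nCk≡n!/k![n-k]! a≤a+b) ⟩
    (a ℕ.+ b) ! ℕ./ (a ! ℕ.* (a ℕ.+ b ∸ a) !) ℕ.* (a ! ℕ.* (a ℕ.+ b ∸ a) !)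
      ≡⟨ ℕ.m/n*n≡m (k![n∸k]!∣n! a≤a+b) ⟩
    (a ℕ.+ b) ! ∎

-- The sequence d, e, d + 1, e + 1, d + 2, ...: the two arguments swap roles at each step.
interlace : ℕ → ℕ → ℕ → ℕ
interlace d e zero    = d
interlace d e (suc l) = interlace e (suc d) l

interlace-pos : ∀ d e l → 0ℚ < ℕtoℚ (interlace (suc d) (suc e) l)
interlace-pos d e zero    = ℕtoℚ-mono-< {0} {suc d} z<s
interlace-pos d e (suc l) = interlace-pos e (suc d) l

-- Each pair of factors, x + d + 1 and x + e + 1, raises both factorials by one. The degree is
-- written `a * 2` so that a successor of `a` unfolds to exactly two factors.
interlaced-factorials : ∀ d e a x →
  (x ℕ.+ d) !ℚ * (x ℕ.+ e) !ℚ * shifted (ℕtoℚ ∘ interlace (suc d) (suc e)) (a ℕ.* 2) (ℕtoℚ x)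
    ≡ (x ℕ.+ d ℕ.+ a) !ℚ * (x ℕ.+ e ℕ.+ a) !ℚ
interlaced-factorials d e zero    x = begin
  (x ℕ.+ d) !ℚ * (x ℕ.+ e) !ℚ * 1ℚ
    ≡⟨ ℚ.*-identityʳ ((x ℕ.+ d) !ℚ * (x ℕ.+ e) !ℚ) ⟩
  (x ℕ.+ d) !ℚ * (x ℕ.+ e) !ℚ
    ≡⟨ cong₂ (λ k l → k !ℚ * l !ℚ) (ℕ.+-identityʳ (x ℕ.+ d)) (ℕ.+-identityʳ (x ℕ.+ e)) ⟨
  (x ℕ.+ d ℕ.+ 0) !ℚ * (x ℕ.+ e ℕ.+ 0) !ℚ ∎
  where open ≡-Reasoning
interlaced-factorials d e (suc a) x = begin
  (x ℕ.+ d) !ℚ * (x ℕ.+ e) !ℚ * ((ℕtoℚ x + ℕtoℚ (suc d)) * ((ℕtoℚ x + ℕtoℚ (suc e)) * rest))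
    ≡⟨ solve 5 (λ D E u v p → D :* E :* (u :* (v :* p)) := u :* D :* (v :* E) :* p) refl
         ((x ℕ.+ d) !ℚ) ((x ℕ.+ e) !ℚ) (ℕtoℚ x + ℕtoℚ (suc d)) (ℕtoℚ x + ℕtoℚ (suc e)) rest ⟩
  (ℕtoℚ x + ℕtoℚ (suc d)) * (x ℕ.+ d) !ℚ * ((ℕtoℚ x + ℕtoℚ (suc e)) * (x ℕ.+ e) !ℚ) * rest
    ≡⟨ cong₂ (λ D E → D * E * rest) (absorb d) (absorb e) ⟩
  (x ℕ.+ suc d) !ℚ * (x ℕ.+ suc e) !ℚ * rest
    ≡⟨ interlaced-factorials (suc d) (suc e) a x ⟩
  (x ℕ.+ suc d ℕ.+ a) !ℚ * (x ℕ.+ suc e ℕ.+ a) !ℚ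
    ≡⟨ cong₂ (λ k l → k !ℚ * l !ℚ) (shift d) (shift e) ⟩
  (x ℕ.+ d ℕ.+ suc a) !ℚ * (x ℕ.+ e ℕ.+ suc a) !ℚ ∎
  where
  open ≡-Reasoning
  rest : ℚ
  rest = shifted (ℕtoℚ ∘ interlace (suc (suc d)) (suc (suc e))) (a ℕ.* 2) (ℕtoℚ x)
  absorb : ∀ d → (ℕtoℚ x + ℕtoℚ (suc d)) * (x ℕ.+ d) !ℚ ≡ (x ℕ.+ suc d) !ℚ
  absorb d = begin
    (ℕtoℚ x + ℕtoℚ (suc d)) * (x ℕ.+ d) !ℚ ≡⟨ cong (_* (x ℕ.+ d) !ℚ) (ℕtoℚ-homo-+ x (suc d)) ⟨
    ℕtoℚ (x ℕ.+ suc d) * (x ℕ.+ d) !ℚ      ≡⟨ ℕtoℚ-homo-* (x ℕ.+ suc d) ((x ℕ.+ d) !) ⟨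
    ℕtoℚ ((x ℕ.+ suc d) ℕ.* (x ℕ.+ d) !)   ≡⟨ cong (λ k → ℕtoℚ (k ℕ.* (x ℕ.+ d) !)) (ℕ.+-suc x d) ⟩
    (suc (x ℕ.+ d)) !ℚ                     ≡⟨ cong _!ℚ (ℕ.+-suc x d) ⟨
    (x ℕ.+ suc d) !ℚ                       ∎
  shift : ∀ d → x ℕ.+ suc d ℕ.+ a ≡ x ℕ.+ d ℕ.+ suc a
  shift d = trans (cong (ℕ._+ a) (ℕ.+-suc x d)) (sym (ℕ.+-suc (x ℕ.+ d) a))

-- The product of the rising factorials of length a starting at x + 1 and at x + m + 2.
nodePolynomial : ℕ → ℕ → ℚ → ℚ
nodePolynomial m a = shifted (ℕtoℚ ∘ interlace 1 (suc (suc m))) (a ℕ.* 2)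

-- With n = m + a + k, the denominators of the two binomials are (k + 1)! (m + a + 1)! and k! a!;
-- the scales group them by row and by column. The summand 0 in `columnWeight` matches
-- `interlaced-factorials` at `d = 0`.
rowScale columnScale columnWeight : ℕ → ℕ → ℚ
rowScale     m a = (suc (m ℕ.+ a)) !ℚ * a !ℚ
columnScale  m k = (suc k) !ℚ * k !ℚ
columnWeight m k = ℕtoℚ (suc m) * ((k ℕ.+ 0) !ℚ * (k ℕ.+ suc m) !ℚ)

NAsq-scaled : ∀ m a k →
  rowScale m a * (columnScale m k * NAsq m a k) ≡ columnWeight m k * nodePolynomial m a (ℕtoℚ k)
NAsq-scaled m a k = begin
  R * A * (K * L * (ρ * B * ℕtoℚ ((n ∸ m) C k)))
    ≡⟨ cong (λ j → R * A * (K * L * (ρ * B * ℕtoℚ (j C k)))) n∸m≡k+a ⟩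
  R * A * (K * L * (ρ * B * B′))
    ≡⟨ solve 7 (λ R A K L ρ B B′ → R :* A :* (K :* L :* (ρ :* B :* B′))
                  := ρ :* (B :* (K :* R)) :* (B′ :* (L :* A))) refl R A K L ρ B B′ ⟩
  ρ * (B * (K * R)) * (B′ * (L * A))
    -- The first binomial becomes (n + 2)!, whose leading factor then cancels the denominator of
    -- `ρ`.
    ≡⟨ cong₂ (λ p q → ρ * p * q) binomial₁ (C-factorials k a) ⟩
  ρ * (ℕtoℚ (suc (suc n)) * (suc n) !ℚ) * (k ℕ.+ a) !ℚ
    ≡⟨ solve 4 (λ ρ s f g → ρ :* (s :* f) :* g := ρ :* s :* (g :* f)) refl
         ρ (ℕtoℚ (suc (suc n))) ((suc n) !ℚ) ((k ℕ.+ a) !ℚ) ⟩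
  ρ * ℕtoℚ (suc (suc n)) * ((k ℕ.+ a) !ℚ * (suc n) !ℚ)
    ≡⟨ cong (_* ((k ℕ.+ a) !ℚ * (suc n) !ℚ)) (/-cancel (suc m) (suc n)) ⟩
  ℕtoℚ (suc m) * ((k ℕ.+ a) !ℚ * (suc n) !ℚ)
    ≡⟨ cong₂ (λ i j → ℕtoℚ (suc m) * (i !ℚ * j !ℚ)) (cong (ℕ._+ a) (sym (ℕ.+-identityʳ k))) 1+n≡ ⟩
  ℕtoℚ (suc m) * ((k ℕ.+ 0 ℕ.+ a) !ℚ * (k ℕ.+ suc m ℕ.+ a) !ℚ)
    ≡⟨ cong (ℕtoℚ (suc m) *_) (interlaced-factorials 0 (suc m) a k) ⟨
  ℕtoℚ (suc m) * ((k ℕ.+ 0) !ℚ * (k ℕ.+ suc m) !ℚ * nodePolynomial m a (ℕtoℚ k))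
    ≡⟨ ℚ.*-assoc (ℕtoℚ (suc m)) ((k ℕ.+ 0) !ℚ * (k ℕ.+ suc m) !ℚ) (nodePolynomial m a (ℕtoℚ k)) ⟨
  columnWeight m k * nodePolynomial m a (ℕtoℚ k) ∎
  where
  open ≡-Reasoning
  n : ℕ
  n = m ℕ.+ a ℕ.+ k
  R A K L ρ B B′ : ℚ
  R  = (suc (m ℕ.+ a)) !ℚ
  A  = a !ℚ
  K  = (suc k) !ℚ
  L  = k !ℚ
  ρ  = (ℤ.+ suc m) / suc (suc n)
  B  = ℕtoℚ ((n ℕ.+ 2) C (k ℕ.+ 1))
  B′ = ℕtoℚ ((k ℕ.+ a) C k)
  n∸m≡k+a : n ∸ m ≡ k ℕ.+ a
  n∸m≡k+a = trans (cong (_∸ m) (ℕ.+-assoc m a k)) (trans (ℕ.m+n∸m≡n m (a ℕ.+ k)) (ℕ.+-comm a k))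
  n+2≡ : n ℕ.+ 2 ≡ suc k ℕ.+ suc (m ℕ.+ a)
  n+2≡ = trans (ℕ.+-comm n 2) (cong suc (trans (cong suc (ℕ.+-comm (m ℕ.+ a) k)) (sym (ℕ.+-suc k (m ℕ.+ a)))))
  binomial₁ : B * (K * R) ≡ ℕtoℚ (suc (suc n)) * (suc n) !ℚ
  binomial₁ = begin
    B * (K * R)
      ≡⟨ cong₂ (λ i j → ℕtoℚ (i C j) * (K * R)) n+2≡ (ℕ.+-comm k 1) ⟩
    ℕtoℚ ((suc k ℕ.+ suc (m ℕ.+ a)) C suc k) * (K * R)
      ≡⟨ C-factorials (suc k) (suc (m ℕ.+ a)) ⟩
    (suc k ℕ.+ suc (m ℕ.+ a)) !ℚ
      ≡⟨ cong _!ℚ (trans (sym n+2≡) (ℕ.+-comm n 2)) ⟩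
    (suc (suc n)) !ℚ
      ≡⟨ ℕtoℚ-homo-* (suc (suc n)) ((suc n) !) ⟩
    ℕtoℚ (suc (suc n)) * (suc n) !ℚ ∎
  1+n≡ : suc n ≡ k ℕ.+ suc m ℕ.+ a
  1+n≡ = trans (ℕ.+-comm (suc (m ℕ.+ a)) k) (sym (ℕ.+-assoc k (suc m) a))

-- Nodes from the chosen columns, and assembly of the theorem.

extend : ∀ {n} → (Fin n → ℕ) → ℕ → ℕ
-- Padding past the last column: as a node it only has to be nonnegative.
extend {zero}  f l       = 0
extend {suc n} f zero    = f zero
extend {suc n} f (suc l) = extend (f ∘ suc) l

extend-toℕ : ∀ {n} (f : Fin n → ℕ) i → extend f (toℕ i) ≡ f i
extend-toℕ f zero    = refl
extend-toℕ f (suc i) = extend-toℕ (f ∘ suc) i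

extend-increasing : ∀ {n} {f : Fin n → ℕ} → StrictlyIncreasing f →
  ∀ {k l} → k ℕ.< l → l ℕ.< n → extend f k ℕ.< extend f l
extend-increasing {f = f} f↗ k<l l<n = subst₂ ℕ._<_ (value (ℕ.<-trans k<l l<n)) (value l<n)
  (f↗ (fromℕ< (ℕ.<-trans k<l l<n)) (fromℕ< l<n)
    (subst₂ ℕ._<_ (sym (toℕ-fromℕ< (ℕ.<-trans k<l l<n))) (sym (toℕ-fromℕ< l<n)) k<l))
  where
  value : ∀ {l} (l<n : l ℕ.< _) → f (fromℕ< l<n) ≡ extend f l
  value l<n = trans (sym (extend-toℕ f (fromℕ< l<n))) (cong (extend f) (toℕ-fromℕ< l<n))

theorem3p3 : (m : ℕ) → STP (NAsq m)
theorem3p3 m r rows cols rows↗ cols↗ = cancel (subst (0ℚ <_) scaling weighted-pos)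
  where
  open ≡-Reasoning
  y : ℕ → ℚ
  y = ℕtoℚ ∘ extend cols
  -- Row a carries the polynomial of degree 2a, so the minor selects even degrees.
  degrees : Fin (suc r) → ℕ
  degrees i = rows i ℕ.* 2
  U V W : ℚ
  U = ∏ (λ i → rowScale m (rows i))
  V = ∏ (λ j → columnScale m (cols j))
  W = ∏ (λ j → columnWeight m (cols j))
  M N : Matrix (suc r)
  M i j = NAsq m (rows i) (cols j)
  N i j = nodePolynomial m (rows i) (ℕtoℚ (cols j))
  N-pos : 0ℚ < det N
  N-pos = subst (0ℚ <_)
    (det-cong λ i j → cong (nodePolynomial m (rows i) ∘ ℕtoℚ) (extend-toℕ cols j))
    (shifted-minor-pos y (ℕtoℚ-nonNeg ∘ extend cols)
      (λ k<l l<n → ℕtoℚ-mono-< (extend-increasing cols↗ k<l l<n))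
      (interlace-pos 0 (suc m)) degrees
      (λ i j i<j → ℕ.*-monoˡ-< 2 (rows↗ i j i<j)))
  weighted-pos : 0ℚ < W * det N
  weighted-pos = pos*pos
    (∏-pos λ j → pos*pos (ℕtoℚ-mono-< {0} {suc m} z<s)
      (pos*pos (!ℚ-pos (cols j ℕ.+ 0)) (!ℚ-pos (cols j ℕ.+ suc m)))) N-pos
  scaling : W * det N ≡ U * (V * det M)
  scaling = begin
    W * det N
      ≡⟨ det-scale-columns (columnWeight m ∘ cols) N ⟨
    det (λ i j → columnWeight m (cols j) * N i j)
      ≡⟨ (det-cong λ i j → NAsq-scaled m (rows i) (cols j)) ⟨
    det (λ i j → rowScale m (rows i) * (columnScale m (cols j) * M i j))
      ≡⟨ det-scale-rows (rowScale m ∘ rows) (λ i j → columnScale m (cols j) * M i j) ⟩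
    U * det (λ i j → columnScale m (cols j) * M i j)
      ≡⟨ cong (U *_) (det-scale-columns (columnScale m ∘ cols) M) ⟩
    U * (V * det M) ∎
  pos-cancel : ∀ p {q} → 0ℚ < p → 0ℚ < p * q → 0ℚ < q
  pos-cancel p 0<p 0<pq = ℚ.*-cancelˡ-<-nonNeg p {{nonNegative (ℚ.<⇒≤ 0<p)}}
    (subst (_< p * _) (sym (ℚ.*-zeroʳ p)) 0<pq)
  cancel : 0ℚ < U * (V * det M) → 0ℚ < det M
  cancel = pos-cancel V (∏-pos λ j → pos*pos (!ℚ-pos (suc (cols j))) (!ℚ-pos (cols j)))
         ∘ pos-cancel U (∏-pos λ i → pos*pos (!ℚ-pos (suc (m ℕ.+ rows i))) (!ℚ-pos (rows i)))
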